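{- Let $\mathcal I,\mathcal J$ be ideals on $\omega$ and let $\mathcal F\subseteq\omega^\omega$. If $\mathfrak{fip}(\mathcal I,\mathcal J,\mathcal F)\ge|\mathcal F|$, then there exists an ultrafilter $\mathcal U$ on $\omega$ such that $\mathcal I\not\le_{\mathcal F}\mathcal U^*$ and $\mathcal J\subseteq\mathcal U^*$. In particular, if (under this assumption) $\mathcal F=\omega^\omega$ ($\mathcal F$ is the family of all finite-to-one functions, or $\mathcal F$ is the family of all one-to-one functions $\omega\to\omega$, respectively), then there exists an $\mathcal I$-ultrafilter (a weak $\mathcal I$-ultrafilter, or an $\mathcal I$-point, respectively) which is not a $\mathcal J$-point.
   Context: An ideal on $\omega$ is a family of subsets of $\omega$ closed under finite unions and subsets, containing all finite sets and not containing $\omega$; $\mathcal J^+=\mathcal P(\omega)\setminus\mathcal J$. Ultrafilters on $\omega$ contain all cofinite sets; $\mathcal U^*=\{\omega\setminus A:A\in\mathcal U\}$ is the dual ideal. For $\mathcal F\subseteq\omega^\omega$ and ideals $\mathcal I,\mathcal K$ on $\omega$, $\mathcal I\le_{\mathcal F}\mathcal K$ means that there is $f\in\mathcal F$ with $f^{ -1}[B]\in\mathcal K$ for every $B\in\mathcal I$. A nonempty family $\mathcal A\subseteq\mathcal P(\omega)$ has $\mathcal J^+$-FIP if $\bigcap F\in\mathcal J^+$ for each finite $F\subseteq\mathcal A$. With $\mathfrak c=2^{\aleph_0}$ and $\mathfrak c^+$ its successor cardinal, $\mathfrak{fip}(\mathcal I,\mathcal J,\mathcal F)$ is the minimum of the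 set consisting of $\mathfrak c^+$ and all cardinals $|\mathcal A|$ such that $\mathcal A$ has $\mathcal J^+$-FIP (so $\mathcal A$ is a nonempty family of subsets of $\omega$) and it is not true that for every $f\in\mathcal F$ there is $B\in\mathcal I$ such that $\mathcal A\cup\{f^{ -1}[B]\}$ has $\mathcal J^+$-FIP. An ultrafilter $\mathcal U$ on $\omega$ is an $\mathcal I$-ultrafilter (weak $\mathcal I$-ultrafilter, $\mathcal I$-point, respectively) if $\mathcal I\not\le_{\mathcal F}\mathcal U^*$ where $\mathcal F$ is the family of all (all finite-to-one, all one-to-one, respectively) functions $\omega\to\omega$; a $\mathcal J$-point is defined in the same way with $\mathcal J$ in place of $\mathcal I$. A function is finite-to-one if preimages of points are finite.
   Formalization: The first claim is proved under the extra condition that fip(I,J,F) > |F| when F has exactly one element; without it the claim is false (I = J = the finite sets, F = {id}, where fip = 1). The "in particular" cases need no such condition. -}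

module Defs where

open import Axiom.ExcludedMiddle using (ExcludedMiddle)
open import Data.List.Base using (List; foldr)
import Data.List.Membership.Propositional as List
open import Data.List.Relation.Unary.All using (All)
open import Data.Nat.Base using (ℕ)
open import Data.Product.Base using (Σ; ∃; ∃-syntax; _×_; proj₁)
open import Data.Sum.Base using (_⊎_)
open import Function.Bundles using (Func; Injection; Bijection)
open import Function.Definitions using (Injective)
open import Level using (0ℓ; Setω; _⊔_) renaming (suc to lsuc)
open import Relation.Binary.Bundles using (Setoid)
open import Relation.Binary.Core using (REL)
open import Relation.Binary.Definitions using (_Respectsˡ_; _Respectsʳ_)
import Relation.Binary.Construct.On as On
open import Relation.Binary.PropositionalEquality using (_≡_; _≗_; _→-setoid_)
open import Relation.Nullary.Negation using (¬_)
open import Relation.Unary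
  using (Pred; _∈_; _∉_; _⊆_; _≐_; _∩_; _∪_; ∅; U; ∁; ｛_｝; _⊢_; Satisfiable)
open import Relation.Unary.Relation.Binary.Equality using (≐-setoid)

-- The ambient theory is ZFC, so its two non-constructive principles are named
-- here in order to be assumed explicitly.

LEM : Setω
LEM = ∀ {ℓ} → ExcludedMiddle ℓ

-- A set is a setoid, so the choice function has to respect the equality.
-- (Choice without this requirement is provable, and is not the axiom of set
-- theory.)

AxiomOfChoice : Setω
AxiomOfChoice =
  ∀ {a ℓ₁ b ℓ₂ r} (S : Setoid a ℓ₁) (T : Setoid b ℓ₂) →
  let module S = Setoid S
      module T = Setoid T
  in (R : REL S.Carrier T.Carrier r) →
     R Respectsˡ S._≈_ → R Respectsʳ T._≈_ →
     (∀ x → ∃[ y ] R x y) →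
     ∃[ f ] (∀ x → R x (Func.to {From = S} {To = T} f x))

-- Subsets of ω are compared by _≐_ and functions ω → ω by _≗_.  Families live
-- one universe up, so that they may be defined by quantifying over subsets.

Subset : Set₁
Subset = Pred ℕ 0ℓ

Family : Set₂
Family = Pred Subset (lsuc 0ℓ)

FunctionFamily : Set₂
FunctionFamily = Pred (ℕ → ℕ) (lsuc 0ℓ)

Finite : Subset → Set
Finite X = Σ (List ℕ) λ xs → X ≐ (List._∈ xs)

record IsIdeal (𝓘 : Family) : Set₁ where
  field
    ∪-closed        : ∀ {X Y} → X ∈ 𝓘 → Y ∈ 𝓘 → (X ∪ Y) ∈ 𝓘
    ⊆-closed        : ∀ {X Y} → X ⊆ Y → Y ∈ 𝓘 → X ∈ 𝓘
    contains-finite : ∀ {X} → Finite X → X ∈ 𝓘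
    proper          : U ∉ 𝓘

infix 10 _⁺
_⁺ : Family → Family
𝓙 ⁺ = ∁ 𝓙

record IsUltrafilter (𝓤 : Family) : Set₁ where
  field
    ∩-closed          : ∀ {X Y} → X ∈ 𝓤 → Y ∈ 𝓤 → (X ∩ Y) ∈ 𝓤
    ⊇-closed          : ∀ {X Y} → X ⊆ Y → X ∈ 𝓤 → Y ∈ 𝓤
    contains-cofinite : ∀ {X} → Finite (∁ X) → X ∈ 𝓤
    proper            : ∅ ∉ 𝓤
    ultra             : ∀ X → X ∈ 𝓤 ⊎ ∁ X ∈ 𝓤

infix 10 _*
_* : Family → Family
(𝓤 *) X = ∃[ A ] (A ∈ 𝓤 × X ≐ ∁ A)

infix 4 _≤[_]_
_≤[_]_ : ∀ {ℓ} → Family → Pred (ℕ → ℕ) ℓ → Family → Set (lsuc 0ℓ ⊔ ℓ)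
𝓘 ≤[ 𝓕 ] 𝓚 = ∃[ f ] (f ∈ 𝓕 × (∀ B → B ∈ 𝓘 → (f ⊢ B) ∈ 𝓚))

AllFunctions FiniteToOne OneToOne : Pred (ℕ → ℕ) 0ℓ
AllFunctions  = U
FiniteToOne f = ∀ n → Finite (f ⊢ ｛ n ｝)
OneToOne    f = Injective _≡_ _≡_ f

IsIUltrafilter : Family → Family → Set₁
IsIUltrafilter 𝓘 𝓤 = IsUltrafilter 𝓤 × ¬ 𝓘 ≤[ AllFunctions ] 𝓤 *

IsWeakIUltrafilter : Family → Family → Set₁
IsWeakIUltrafilter 𝓘 𝓤 = IsUltrafilter 𝓤 × ¬ 𝓘 ≤[ FiniteToOne ] 𝓤 *

IsIPoint : Family → Family → Set₁
IsIPoint 𝓘 𝓤 = IsUltrafilter 𝓤 × ¬ 𝓘 ≤[ OneToOne ] 𝓤 *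

-- A finite subfamily is given by a list; the empty one has intersection ω.

HasFIP : Family → Family → Set₁
HasFIP 𝓙 𝓐 =
  Satisfiable 𝓐 ×
  (∀ (Xs : List Subset) → All (_∈ 𝓐) Xs → foldr _∩_ U Xs ∈ 𝓙 ⁺)

infixl 6 _∪｛_｝
_∪｛_｝ : Family → Subset → Family
𝓐 ∪｛ X ｝ = 𝓐 ∪ (_≐ X)

-- A cardinal is represented by any setoid having that cardinality.  All the
-- cardinals that matter here are realised at the level of Cardinal; the
-- comparisons are level-polymorphic, so nothing needs lifting.

Cardinal : Set₂
Cardinal = Setoid (lsuc 0ℓ) (lsuc 0ℓ)

module _ {a ℓ₁ b ℓ₂} (κ : Setoid a ℓ₁) (μ : Setoid b ℓ₂) where

  infix 4 _≤ᶜ_ _≈ᶜ_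

  _≤ᶜ_ : Set (a ⊔ ℓ₁ ⊔ b ⊔ ℓ₂)
  _≤ᶜ_ = Injection κ μ

  _≈ᶜ_ : Set (a ⊔ ℓ₁ ⊔ b ⊔ ℓ₂)
  _≈ᶜ_ = Bijection κ μ

infix 4 _<ᶜ_
_<ᶜ_ : ∀ {a ℓ₁ b ℓ₂} → Setoid a ℓ₁ → Setoid b ℓ₂ → Set (a ⊔ ℓ₁ ⊔ b ⊔ ℓ₂)
κ <ᶜ μ = κ ≤ᶜ μ × ¬ (μ ≤ᶜ κ)

∣_∣ : Family → Setoid (lsuc 0ℓ) 0ℓ
∣ 𝓐 ∣ = On.setoid {B = Σ Subset 𝓐} (≐-setoid ℕ 0ℓ) proj₁

∣_∣ᶠ : FunctionFamily → Setoid (lsuc 0ℓ) 0ℓ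
∣ 𝓕 ∣ᶠ = On.setoid {B = Σ (ℕ → ℕ) 𝓕} (ℕ →-setoid ℕ) proj₁

𝔠 : Setoid (lsuc 0ℓ) 0ℓ
𝔠 = ≐-setoid ℕ 0ℓ

IsSuccessorOf𝔠 : Cardinal → Set₂
IsSuccessorOf𝔠 κ = 𝔠 <ᶜ κ × (∀ (ν : Cardinal) → 𝔠 <ᶜ ν → κ ≤ᶜ ν)

module _ (𝓘 𝓙 : Family) (𝓕 : FunctionFamily) where

  FIPWitness : Family → Set₁
  FIPWitness 𝓐 =
    HasFIP 𝓙 𝓐 ×
    ¬ (∀ f → f ∈ 𝓕 → ∃[ B ] (B ∈ 𝓘 × HasFIP 𝓙 (𝓐 ∪｛ f ⊢ B ｝)))

  FIPCandidate : Cardinal → Set₂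
  FIPCandidate κ = IsSuccessorOf𝔠 κ ⊎ ∃[ 𝓐 ] (FIPWitness 𝓐 × κ ≈ᶜ ∣ 𝓐 ∣)

  -- κ = 𝔣𝔦𝔭(𝓘,𝓙,𝓕): the least element of the set of candidates.
  IsFIPNumber : Cardinal → Set₂
  IsFIPNumber κ =
    FIPCandidate κ × (∀ (ν : Cardinal) → FIPCandidate ν → κ ≤ᶜ ν)

-- The only degenerate case: if ∣𝓕∣ = 1 then 𝔣𝔦𝔭 ≥ ∣𝓕∣ always holds, since
-- families with the FIP are nonempty, and so it says nothing.  For example, if
-- 𝓘 = 𝓙 is the ideal of finite sets and 𝓕 = {id}, then 𝔣𝔦𝔭 = 1 (take 𝓐 = {ω}),
-- yet 𝓘 ≤[ 𝓕 ] 𝓤 * for every ultrafilter 𝓤.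

IsSingleton : FunctionFamily → Set₁
IsSingleton 𝓕 = ∃[ f ] (f ∈ 𝓕 × (∀ g → g ∈ 𝓕 → g ≗ f))

{-# OPTIONS --safe #-}
module Submission where

-- Well-order 𝓕 so that no proper initial segment has cardinality ∣𝓕∣ and choose
-- sets B_f ∈ 𝓘 by recursion on f.  The family of the f′⁻¹[B_f′] with f′ < f has
-- fewer than ∣𝓕∣ ≤ 𝔣𝔦𝔭 members, so it is not a witness for 𝔣𝔦𝔭 and B_f exists.
-- The ideal generated by 𝓙 and the complements of all f⁻¹[B_f] is then proper,
-- and any ultrafilter whose dual ideal contains it is as required.

open import Defs
open import Data.Empty using (⊥-elim)
open import Data.List.Base using (List; []; _∷_; _++_; foldr)
open import Data.List.Relation.Unary.All as All using (All; []; _∷_)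
open import Data.List.Relation.Unary.Any using (here)
open import Data.List.Relation.Unary.All.Properties using (++⁺)
open import Data.Nat.Base using (ℕ; suc)
open import Data.Nat.Properties using (suc-injective)
open import Data.Product.Base using (Σ; ∃; ∃-syntax; _×_; _,_; proj₁; proj₂)
open import Data.Product.Relation.Binary.Pointwise.NonDependent using (×-setoid)
open import Data.Sum.Base using (_⊎_; inj₁; inj₂; [_,_]′)
open import Data.Unit.Base using (⊤; tt)
open import Function.Base using (_∘_; _on_; id)
open import Function.Bundles using (Func; Injection; Bijection)
import Function.Construct.Composition as Composition
open import Induction.WellFounded
  using (Acc; acc; WellFounded; module FixPoint)
  renaming (module All to WF)
open import Level using (Level; 0ℓ; _⊔_; Lift; lift; lower) renaming (suc to lsuc)
open import Relation.Binary.Bundles using (Setoid)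
import Relation.Binary.Construct.On as On
open import Relation.Binary.Core using (Rel; REL)
open import Relation.Binary.Definitions
  using (Transitive; _Respectsˡ_; _Respectsʳ_)
open import Relation.Binary.PropositionalEquality
  using (_≡_; _≗_; refl; sym; trans; subst)
import Relation.Binary.PropositionalEquality.Properties as ≡
open import Relation.Nullary.Decidable.Core
  using (yes; no; True; toWitness; fromWitness; decidable-stable)
open import Relation.Nullary.Negation using (¬_; contradiction)
open import Relation.Unary
  using (Pred; _∈_; _∉_; _⊆_; _≐_; _∩_; _∪_; ∅; U; ∁; _⊢_; Satisfiable)
open import Relation.Unary.Properties using (≐-refl; ≐-sym; ≐-trans)
open import Relation.Unary.Relation.Binary.Equality using (≐-setoid)

private
  variable
    a b ℓ ℓ₁ ℓ₂ r : Level

  1ℓ : Level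
  1ℓ = lsuc 0ℓ

-- Well-orders on setoids.

record WellOrder (S : Setoid a ℓ) (r : Level) : Set (a ⊔ ℓ ⊔ lsuc r) where
  open Setoid S using (Carrier; _≈_)
  infix 4 _<_ _≤_
  field
    _<_       : Rel Carrier r
    <-respʳ   : _<_ Respectsʳ _≈_
    <-respˡ   : _<_ Respectsˡ _≈_
    <-trans   : Transitive _<_
    compare   : ∀ x y → x < y ⊎ x ≈ y ⊎ y < x
    <-wellFounded : WellFounded _<_

  _≤_ : Rel Carrier (ℓ ⊔ r)
  x ≤ y = x < y ⊎ x ≈ y

  ≤-<-trans : ∀ {x y z} → x ≤ y → y < z → x < z
  ≤-<-trans (inj₁ x<y) y<z = <-trans x<y y<z
  ≤-<-trans (inj₂ x≈y) y<z = <-respˡ (Setoid.sym S x≈y) y<z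

  below : Carrier → Pred Carrier r
  below x = _< x

  ↓ : Carrier → Setoid (a ⊔ r) ℓ
  ↓ x = On.setoid {B = Σ Carrier (_< x)} S proj₁

pullback : {S : Setoid a ℓ₁} {T : Setoid b ℓ₂} → S ≤ᶜ T → WellOrder T r → WellOrder S r
pullback f W = record
  { _<_           = _<_ on to
  ; <-respʳ       = λ y≈z → <-respʳ (Injection.cong f y≈z)
  ; <-respˡ       = λ y≈z → <-respˡ (Injection.cong f y≈z)
  ; <-trans       = <-trans
  ; compare       = λ x y → [ inj₁ , inj₂ ∘ [ inj₁ ∘ injective , inj₂ ]′ ]′ (compare (to x) (to y))
  ; <-wellFounded = On.wellFounded to <-wellFounded
  }
  where
  open WellOrder W
  open Injection f using (to; injective)

-- The finite intersection property and the ideals it generates.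

⋂ : List Subset → Subset
⋂ = foldr _∩_ U

-- The part of `HasFIP` without nonemptiness: a transfinite recursion starts from the empty family.
FIP : Family → Family → Set₁
FIP 𝓙 𝓐 = ∀ Xs → All (_∈ 𝓐) Xs → ⋂ Xs ∈ 𝓙 ⁺

FIP-antitone : ∀ 𝓙 {𝓐 𝓑} → 𝓐 ⊆ 𝓑 → FIP 𝓙 𝓑 → FIP 𝓙 𝓐
FIP-antitone _ 𝓐⊆𝓑 fip Xs Xs⊆𝓐 = fip Xs (All.map 𝓐⊆𝓑 Xs⊆𝓐)

⋂-++⁻ : ∀ Xs {Ys} → ⋂ (Xs ++ Ys) ⊆ ⋂ Xs ∩ ⋂ Ys
⋂-++⁻ []       x∈         = tt , x∈
⋂-++⁻ (X ∷ Xs) (x∈X , x∈) = let x∈Xs , x∈Ys = ⋂-++⁻ Xs x∈ in (x∈X , x∈Xs) , x∈Ys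

∅-finite : Finite ∅
∅-finite = [] , (λ ()) , (λ ())

-- The ideal generated by `𝓙` and the complements of the members of `𝓐`. For an ideal `𝓙`, it is
-- proper exactly when `FIP 𝓙 𝓐` holds.
Generated : Family → Family → Family
Generated 𝓙 𝓐 X = ∃[ Ys ] (All (_∈ 𝓐) Ys × (X ∩ ⋂ Ys) ∈ 𝓙)

module _ {𝓙 𝓐 : Family} (𝓙-ideal : IsIdeal 𝓙) where
  open IsIdeal 𝓙-ideal

  Generated-isIdeal : FIP 𝓙 𝓐 → IsIdeal (Generated 𝓙 𝓐)
  Generated-isIdeal fip = record
    { ∪-closed = λ { (Xs , Xs⊆𝓐 , X∈) (Ys , Ys⊆𝓐 , Y∈) →
        Xs ++ Ys , ++⁺ Xs⊆𝓐 Ys⊆𝓐 ,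
        ⊆-closed
          (λ { (inj₁ x∈X , x∈) → inj₁ (x∈X , proj₁ (⋂-++⁻ Xs x∈))
             ; (inj₂ x∈Y , x∈) → inj₂ (x∈Y , proj₂ (⋂-++⁻ Xs x∈)) })
          (∪-closed X∈ Y∈) }
    ; ⊆-closed = λ { X⊆Y (Ys , Ys⊆𝓐 , Y∈) →
        Ys , Ys⊆𝓐 , ⊆-closed (λ (x∈X , x∈Ys) → X⊆Y x∈X , x∈Ys) Y∈ }
    ; contains-finite = λ fin → [] , [] , ⊆-closed proj₁ (contains-finite fin)
    ; proper = λ { (Ys , Ys⊆𝓐 , Y∈) → fip Ys Ys⊆𝓐 (⊆-closed (tt ,_) Y∈) }
    }

  ⊆-Generated : 𝓙 ⊆ Generated 𝓙 𝓐
  ⊆-Generated X∈𝓙 = [] , [] , ⊆-closed proj₁ X∈𝓙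

  ∁∈Generated : ∀ {X} → X ∈ 𝓐 → ∁ X ∈ Generated 𝓙 𝓐
  ∁∈Generated {X} X∈𝓐 =
    X ∷ [] , X∈𝓐 ∷ [] ,
    ⊆-closed (λ (x∉X , x∈X , _) → x∉X x∈X) (contains-finite ∅-finite)

-- Otherwise two members of `𝓤`, one inside `∁ X` and one disjoint from `∁ X`, would have empty
-- intersection.
∁∉* : ∀ {𝓤 X} → IsUltrafilter 𝓤 → X ∈ 𝓤 * → ∁ X ∉ 𝓤 *
∁∉* ultrafilter (A , A∈𝓤 , X≐∁A) (B , B∈𝓤 , ∁X≐∁B) =
  proper (⊇-closed
    (λ (x∈A , x∈B) → proj₁ ∁X≐∁B (λ x∈X → proj₁ X≐∁A x∈X x∈A) x∈B)
    (∩-closed A∈𝓤 B∈𝓤))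
  where open IsUltrafilter ultrafilter

image : {A : Set₁} → (A → Subset) → Pred A 1ℓ → Family
image C D Z = ∃[ x ] (x ∈ D × C x ≐ Z)

module Choice (lem : LEM) (ac : AxiomOfChoice) where

  -- Excluded middle, the well-ordering theorem and initial well-orders.

  byContradiction : {P : Set ℓ} → ¬ ¬ P → P
  byContradiction = decidable-stable lem

  -- By excluded middle every proposition can be resized to the lowest universe.
  Small : Set ℓ → Set
  Small P = True (lem {P = P})

  small : {P : Set ℓ} → P → Small P
  small = fromWitness

  large : {P : Set ℓ} → Small P → P
  large = toWitness

  minimal : {A : Set a} {_<_ : Rel A r} → WellFounded _<_ →
            (P : Pred A ℓ) → Satisfiable P → ∃[ x ] (x ∈ P × (∀ y → y < x → y ∉ P))
  minimal wf P (x , x∈P) = byContradiction λ none →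
    WF.wfRec wf _ (_∉ P) (λ y below y∈P → none (y , y∈P , λ z z<y → below z<y)) x x∈P

  -- Zermelo's proof, with the tower of sets generated by X ↦ X ∪ {c(X)} and unions.
  module Tower
    (A : Set a) (c : Pred A 0ℓ → A)
    (c-cong : ∀ {X Y} → X ≐ Y → c X ≡ c Y)
    (c-∉ : ∀ X → ∃ (_∉ X) → c X ∉ X)
    where

    next : Pred A 0ℓ → Pred A 0ℓ
    next X = X ∪ (λ y → Small (c X ≡ y))

    -- The definition quantifies over predicates on `A`, so `Small` is what keeps a union a
    -- predicate of the lowest level, hence a possible stage.
    ⋃ : Pred (Pred A 0ℓ) 0ℓ → Pred A 0ℓ
    ⋃ Q x = Small (∃[ X ] (X ∈ Q × x ∈ X))

    data Stage : Pred A 0ℓ → Set (a ⊔ 1ℓ) where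
      succ : ∀ {X} → Stage X → Stage (next X)
      sup  : ∀ {Q} → (∀ {X} → X ∈ Q → Stage X) → Stage (⋃ Q)

    next-cong : ∀ {X Y} → X ≐ Y → next X ⊆ next Y
    next-cong X≐Y (inj₁ x∈X)  = inj₁ (proj₁ X≐Y x∈X)
    next-cong X≐Y (inj₂ cX≡x) = inj₂ (small (trans (sym (c-cong X≐Y)) (large cX≡x)))

    -- Induction on the stage `Y`, for an `X` already known to be comparable with all stages. In the
    -- successor case the only delicate possibility is that `X` and `Y` include each other; then
    -- their successors agree by `next-cong`.
    succ-linear : ∀ {X Y} → (∀ {Y} → Stage Y → X ⊆ Y ⊎ next Y ⊆ X) →
                  Stage Y → next X ⊆ Y ⊎ Y ⊆ X
    succ-linear X-linear (succ Y) with succ-linear X-linear Y | X-linear Y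
    ... | inj₁ nX⊆Y | _         = inj₁ (inj₁ ∘ nX⊆Y)
    ... | inj₂ _    | inj₂ nY⊆X = inj₂ nY⊆X
    ... | inj₂ Y⊆X  | inj₁ X⊆Y  = inj₁ (next-cong ((λ x∈ → X⊆Y x∈) , (λ x∈ → Y⊆X x∈)))
    succ-linear {X} X-linear (sup {Q} stages) with lem {P = ∃[ Z ] (Z ∈ Q × next X ⊆ Z)}
    ... | yes (Z , Z∈Q , nX⊆Z) = inj₁ λ x∈ → small (Z , Z∈Q , nX⊆Z x∈)
    ... | no none = inj₂ λ x∈ → let Z , Z∈Q , x∈Z = large x∈ in
      [ (λ nX⊆Z → contradiction (Z , Z∈Q , λ {x} → nX⊆Z {x}) none) , (λ Z⊆X → Z⊆X x∈Z) ]′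
        (succ-linear X-linear (stages Z∈Q))

    -- Induction on the stage `X`. The second alternative is `next Y ⊆ X` and not merely `Y ⊆ X`
    -- because the successor case of `succ-linear` needs this stronger form.
    linear : ∀ {X Y} → Stage X → Stage Y → X ⊆ Y ⊎ next Y ⊆ X
    linear (succ X) Y with succ-linear (linear X) Y | linear X Y
    ... | inj₁ nX⊆Y | _         = inj₁ nX⊆Y
    ... | inj₂ _    | inj₂ nY⊆X = inj₂ (inj₁ ∘ nY⊆X)
    ... | inj₂ Y⊆X  | inj₁ X⊆Y  = inj₂ (next-cong ((λ x∈ → Y⊆X x∈) , (λ x∈ → X⊆Y x∈)))
    linear {Y = Y} (sup {Q} stages) YS with lem {P = ∃[ Z ] (Z ∈ Q × next Y ⊆ Z)}
    ... | yes (Z , Z∈Q , nY⊆Z) = inj₂ λ x∈ → small (Z , Z∈Q , nY⊆Z x∈)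
    ... | no none = inj₁ λ x∈ → let Z , Z∈Q , x∈Z = large x∈ in
      [ (λ Z⊆Y → Z⊆Y x∈Z) , (λ nY⊆Z → contradiction (Z , Z∈Q , λ {x} → nY⊆Z {x}) none) ]′
        (linear (stages Z∈Q) YS)

    infix 4 _<_
    _<_ : Rel A (a ⊔ 1ℓ)
    x < y = ∃[ X ] (Stage X × x ∈ X × y ∉ X)

    <-trans : Transitive _<_
    <-trans (X , XS , x∈X , y∉X) (Y , YS , y∈Y , z∉Y) with linear XS YS
    ... | inj₁ X⊆Y  = Y , YS , X⊆Y x∈X , z∉Y
    ... | inj₂ nY⊆X = contradiction (nY⊆X (inj₁ y∈Y)) y∉X

    <-irrefl : ∀ {x} → ¬ (x < x)
    <-irrefl (_ , _ , x∈X , x∉X) = x∉X x∈X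

    -- The union `M` of all stages disjoint from `Q` is the largest such stage. The point `c M`
    -- added next must lie in `Q`, since otherwise `next M` would be a larger one; and `next M`
    -- separates `c M` from every other point of `Q`.
    least : ∀ {ℓ} (Q : Pred A ℓ) → Satisfiable Q →
            ∃[ m ] (m ∈ Q × (∀ {y} → y ∈ Q → m < y ⊎ m ≡ y))
    least {ℓ} Q (q , q∈Q) = m , m∈Q , m-least
      where
      Avoids : Pred (Pred A 0ℓ) (a ⊔ 1ℓ ⊔ ℓ)
      Avoids X = Stage X × (∀ {x} → x ∈ X → x ∉ Q)

      M : Pred A 0ℓ
      M = ⋃ (λ X → Small (Avoids X))

      M-stage : Stage M
      M-stage = sup (proj₁ ∘ large)

      M-avoids : ∀ {x} → x ∈ M → x ∉ Q
      M-avoids x∈M = let _ , X-avoids , x∈X = large x∈M in proj₂ (large X-avoids) x∈X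

      m : A
      m = c M

      m∉M : m ∉ M
      m∉M = c-∉ M (q , λ q∈M → M-avoids q∈M q∈Q)

      m∈Q : m ∈ Q
      m∈Q = byContradiction λ m∉Q → m∉M (small
        ( next M
        , small {P = Avoids (next M)}
            (succ M-stage , [ M-avoids , (λ m≡x → subst (_∉ Q) (large m≡x) m∉Q) ]′)
        , inj₂ (small refl)))

      m-least : ∀ {y} → y ∈ Q → m < y ⊎ m ≡ y
      m-least {y} y∈Q with lem {P = m ≡ y}
      ... | yes m≡y = inj₂ m≡y
      ... | no  m≢y = inj₁ (next M , succ M-stage , inj₂ (small refl) ,
                            [ (λ y∈M → M-avoids y∈M y∈Q) , m≢y ∘ large ]′)

    compare : ∀ x y → x < y ⊎ x ≡ y ⊎ y < x
    compare x y with least (λ z → z ≡ x ⊎ z ≡ y) (x , inj₁ refl)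
    ... | _ , inj₁ refl , ≤all = [ inj₁ , inj₂ ∘ inj₁ ]′ (≤all (inj₂ refl))
    ... | _ , inj₂ refl , ≤all = [ inj₂ ∘ inj₂ , inj₂ ∘ inj₁ ∘ sym ]′ (≤all (inj₁ refl))

    <-wellFounded : WellFounded _<_
    <-wellFounded x = byContradiction λ x-bad →
      let m , m-bad , m-least = least (λ y → ¬ Acc _<_ y) (x , x-bad) in
      m-bad (acc λ y<m → byContradiction λ y-bad →
        [ (λ m<y → <-irrefl (<-trans m<y y<m)) , (λ { refl → <-irrefl y<m }) ]′ (m-least y-bad))

    wellOrder : WellOrder (≡.setoid A) (a ⊔ 1ℓ)
    wellOrder = record
      { _<_           = _<_
      ; <-respʳ       = λ { refl x<y → x<y }
      ; <-respˡ       = λ { refl x<y → x<y }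
      ; <-trans       = <-trans
      ; compare       = compare
      ; <-wellFounded = <-wellFounded
      }

  zermelo-≡ : (A : Set a) → WellOrder (≡.setoid A) (a ⊔ 1ℓ)
  zermelo-≡ A with lem {P = A}
  ... | no ¬a = record
    { _<_           = λ x _ → ⊥-elim (¬a x)
    ; <-respʳ       = λ {x} → ⊥-elim (¬a x)
    ; <-respˡ       = λ {x} → ⊥-elim (¬a x)
    ; <-trans       = λ {x} → ⊥-elim (¬a x)
    ; compare       = λ x → ⊥-elim (¬a x)
    ; <-wellFounded = λ x → ⊥-elim (¬a x)
    }
  ... | yes x₀ = Tower.wellOrder A (Func.to c) (Func.cong c) c-∉
    where
    -- The condition makes the relation total: when `X` is all of `A`, the default `x₀` will do.
    Fresh : REL (Pred A 0ℓ) A _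
    Fresh X y = ∃ (_∉ X) → y ∉ X

    total : ∀ X → ∃ (Fresh X)
    total X with lem {P = ∃ (_∉ X)}
    ... | yes (y , y∉X) = y , λ _ → y∉X
    ... | no full       = x₀ , λ e → contradiction e full

    choice : ∃[ f ] (∀ X → Fresh X (Func.to f X))
    choice = ac (≐-setoid A 0ℓ) (≡.setoid A) Fresh
      (λ (X⊆Y , Y⊆X) fresh (z , z∉Y) y∈Y → fresh (z , z∉Y ∘ X⊆Y) (Y⊆X y∈Y))
      (λ { refl fresh → fresh }) total

    c   = proj₁ choice
    c-∉ = proj₂ choice

  -- The choice function respects `S._≈_` and takes values compared by `≡`, so it picks one
  -- representative from each class. Well-ordering a setoid thus reduces to well-ordering a type
  -- under `≡`.
  representatives : (S : Setoid a ℓ) → S ≤ᶜ ≡.setoid (Setoid.Carrier S)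
  representatives S = record
    { to        = Func.to rep
    ; cong      = Func.cong rep
    ; injective = λ {x} {y} rx≡ry →
        S.trans (≈rep x) (S.trans (S.reflexive rx≡ry) (S.sym (≈rep y)))
    }
    where
    module S = Setoid S
    choice = ac S (≡.setoid S.Carrier) S._≈_
      (λ x≈y x≈z → S.trans (S.sym x≈y) x≈z) (λ { refl x≈y → x≈y }) (λ x → x , S.refl)
    rep  = proj₁ choice
    ≈rep = proj₂ choice

  zermelo : (S : Setoid a ℓ) → WellOrder S (a ⊔ 1ℓ)
  zermelo S = pullback (representatives S) (zermelo-≡ _)

  -- If `S` embeds in some proper segment, take the least such `x` and pull the order back along the
  -- embedding into the segment below `x`. An embedding of `S` in a new segment below `y` would then
  -- give one in the old segment below the image of `y`, which is less than `x`.
  initialWellOrder : {S : Setoid a ℓ} → WellOrder S r →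
                     ∃[ W ] (∀ x → ¬ (S ≤ᶜ WellOrder.↓ {r = r} W x))
  initialWellOrder {S = S} W with lem {P = ∃[ x ] (S ≤ᶜ WellOrder.↓ W x)}
  ... | no  none  = W , λ x S≤↓x → none (x , S≤↓x)
  ... | yes exists =
    let x , S≤↓x , least = minimal W.<-wellFounded (λ x → S ≤ᶜ W.↓ x) exists
        open Injection S≤↓x using (to; cong; injective)
        toS : S ≤ᶜ S
        toS = record { to = proj₁ ∘ to ; cong = cong ; injective = injective }
    in pullback toS W , λ y S≤↓y →
       let module I = Injection S≤↓y in
       least _ (proj₂ (to y)) (record
         { to        = λ z → proj₁ (to (proj₁ (I.to z))) , proj₂ (I.to z)
         ; cong      = cong ∘ I.cong
         ; injective = I.injective ∘ injective
         })
    where module W = WellOrder W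

  -- Choose an index for each member of the image; applying `C` recovers the member, so the choice
  -- is injective.
  ∣image∣≤ : {S : Setoid 1ℓ 0ℓ} (C : Setoid.Carrier S → Subset) →
             (∀ {x y} → Setoid._≈_ S x y → C x ≡ C y) → (D : Pred (Setoid.Carrier S) 1ℓ) →
             ∣ image C D ∣ ≤ᶜ On.setoid {B = Σ (Setoid.Carrier S) D} S proj₁
  ∣image∣≤ {S} C C-cong D = record
    { to        = Func.to f
    ; cong      = Func.cong f
    ; injective = λ {X} {Y} fX≈fY →
        ≐-trans (≐-sym (f-section X))
          (subst (_≐ proj₁ Y) (sym (C-cong fX≈fY)) (f-section Y))
    }
    where
    choice = ac ∣ image C D ∣ (On.setoid {B = Σ (Setoid.Carrier S) D} S proj₁)
      (λ (Z , _) (x , _) → C x ≐ Z)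
      (λ Y≐Z Cx≐Y → ≐-trans Cx≐Y Y≐Z)
      (λ x≈y Cx≐Z → subst (_≐ _) (C-cong x≈y) Cx≐Z)
      (λ (Z , x , x∈D , Cx≐Z) → (x , x∈D) , Cx≐Z)
    f         = proj₁ choice
    f-section = proj₂ choice

  -- Transfinite selection of sets preserving the FIP, used for the functions in `𝓕` and again for
  -- the ultrafilter.

  module Selection
    (𝓙 : Family) (proper : U ∉ 𝓙)
    {S : Setoid 1ℓ 0ℓ} (W : WellOrder S 1ℓ) {o : Level}
    (Option : REL (Setoid.Carrier S) Subset o) (Option-respˡ : Option Respectsˡ Setoid._≈_ S)
    (extend : ∀ x (C : Setoid.Carrier S → Subset) →
              (∀ {y z} → Setoid._≈_ S y z → C y ≡ C z) →
              FIP 𝓙 (image C (WellOrder.below W x)) →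
              ∃[ Z ] (Option x Z × FIP 𝓙 (image C (WellOrder.below W x) ∪｛ Z ｝)))
    where

    open Setoid S using (Carrier; _≈_)
    open WellOrder W
    module S = Setoid S

    -- A state records the sets chosen so far as a bare family, together with the current index.
    -- States are compared up to `≐` and `≈`, so the choice function cannot depend on how they are
    -- presented.
    Good : Family × Carrier → Pred Subset (o ⊔ 1ℓ)
    Good (𝓐 , x) Z = Option x Z × FIP 𝓙 (𝓐 ∪｛ Z ｝)

    stateSetoid : Setoid _ _
    stateSetoid = ×-setoid (≐-setoid Subset 1ℓ) S

    Good-respˡ : Good Respectsˡ (Setoid._≈_ stateSetoid)
    Good-respˡ ((_ , 𝓑⊆𝓐) , x≈y) (opt , fip) =
      Option-respˡ x≈y opt , FIP-antitone 𝓙 [ inj₁ ∘ 𝓑⊆𝓐 , inj₂ ]′ fip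

    total : ∀ s → ∃[ Z ] (∃ (Good s) → Good s Z)
    total s with lem {P = ∃ (Good s)}
    ... | yes (Z , good) = Z , λ _ → good
    ... | no  none       = U , λ e → contradiction e none

    choice : ∃[ f ] (∀ s → ∃ (Good s) → Good s (Func.to f s))
    choice = ac stateSetoid (≡.setoid Subset) (λ s Z → ∃ (Good s) → Good s Z)
      (λ s≈t good (Z , goodₜ) →
        Good-respˡ s≈t (good (Z , Good-respˡ (Setoid.sym stateSetoid s≈t) goodₜ)))
      (λ { refl good → good }) total

    open Func (proj₁ choice) renaming (to to pick; cong to pick-cong)

    earlier : ∀ x → (∀ {y} → y < x → Subset) → Family
    earlier x IH Z = ∃[ y ] Σ (y < x) λ y<x → IH y<x ≐ Z

    recurse : ∀ x → (∀ {y} → y < x → Subset) → Subset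
    recurse x IH = pick (earlier x IH , x)

    -- The history enters only through the family of its values, and `pick` respects `≐`. This is
    -- the extensionality required to unfold the recursion.
    recurse-ext : ∀ x {IH IH′ : ∀ {y} → y < x → Subset} →
                  (∀ {y} (y<x : y < x) → IH y<x ≡ IH′ y<x) → recurse x IH ≡ recurse x IH′
    recurse-ext x eq = pick-cong
      ( ( (λ (y , y<x , e) → y , y<x , subst (_≐ _) (eq y<x) e)
        , (λ (y , y<x , e) → y , y<x , subst (_≐ _) (sym (eq y<x)) e))
      , S.refl)

    C : Carrier → Subset
    C = WF.wfRec <-wellFounded _ (λ _ → Subset) recurse

    C-unfold : ∀ x → C x ≡ pick (image C (_< x) , x)
    C-unfold x = FixPoint.unfold-wfRec <-wellFounded (λ _ → Subset) recurse recurse-ext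

    C-cong : ∀ {x y} → x ≈ y → C x ≡ C y
    C-cong {x} {y} x≈y = trans (C-unfold x) (trans (pick-cong (same , x≈y)) (sym (C-unfold y)))
      where
      same : image C (_< x) ≐ image C (_< y)
      same = (λ (z , z<x , e) → z , <-respʳ x≈y z<x , e)
           , (λ (z , z<y , e) → z , <-respʳ (S.sym x≈y) z<y , e)

    -- A nonempty finite list has a greatest index. The empty list is separate because `D` may have
    -- no element to serve as a bound.
    bounded : ∀ {D Xs} → All (_∈ image C D) Xs →
              Xs ≡ [] ⊎ ∃[ y ] (y ∈ D × All (_∈ image C (_≤ y)) Xs)
    bounded [] = inj₁ refl
    bounded ((x , x∈D , e) ∷ ps) with bounded ps
    ... | inj₁ refl = inj₂ (x , x∈D , (x , inj₂ S.refl , e) ∷ [])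
    ... | inj₂ (y , y∈D , qs) with compare x y
    ...   | inj₁ x<y        = inj₂ (y , y∈D , (x , inj₁ x<y , e) ∷ qs)
    ...   | inj₂ (inj₁ x≈y) = inj₂ (y , y∈D , (x , inj₂ x≈y , e) ∷ qs)
    ...   | inj₂ (inj₂ y<x) = inj₂ (x , x∈D , (x , inj₂ S.refl , e) ∷
        All.map (λ (z , z≤y , e) → z , inj₁ (≤-<-trans z≤y y<x) , e) qs)

    FIP-directed : ∀ {D} → (∀ {y} → y ∈ D → FIP 𝓙 (image C (_≤ y))) → FIP 𝓙 (image C D)
    FIP-directed fip Xs ps with bounded ps
    ... | inj₁ refl           = proper
    ... | inj₂ (y , y∈D , qs) = fip y∈D Xs qs

    -- By induction every segment up to some `y < x` has the FIP, and by `FIP-directed` so does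
    -- their union. Then `extend` shows that a good set exists, and `pick` returns one. Limit
    -- indices need no separate case.
    C-good : ∀ x → C x ∈ Option x × FIP 𝓙 (image C (_≤ x))
    C-good = WF.wfRec <-wellFounded _ _ λ x IH →
      let opt , fip = subst (Good (image C (_< x) , x)) (sym (C-unfold x))
            (proj₂ choice _ (extend x C C-cong (FIP-directed (proj₂ ∘ IH))))
      in opt , FIP-antitone 𝓙
        (λ { (y , inj₁ y<x , e) → inj₁ (y , y<x , e)
           ; (y , inj₂ y≈x , e) → inj₂ (subst (_ ≐_) (C-cong y≈x) (≐-sym e)) })
        fip

    selection : ∃[ C ] ((∀ x → C x ∈ Option x) × (∀ D → FIP 𝓙 (image C D)))
    selection = C , proj₁ ∘ C-good , λ D → FIP-directed (λ {y} _ → proj₂ (C-good y))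

  injective⇒finite-to-one : ∀ {f} → OneToOne f → FiniteToOne f
  injective⇒finite-to-one {f} inj n with lem {P = ∃[ m ] (n ≡ f m)}
  ... | yes (m , n≡fm) = m ∷ [] ,
    (λ n≡fk → here (inj (trans (sym n≡fk) n≡fm))) , (λ { (here refl) → n≡fm })
  ... | no none = [] , (λ n≡fm → ⊥-elim (none (_ , n≡fm))) , (λ ())

  -- Extending an ideal to the dual of an ultrafilter.

  ¬FIP⇒ : ∀ 𝓙 {𝓐} → ¬ FIP 𝓙 𝓐 → ∃[ Xs ] (All (_∈ 𝓐) Xs × ⋂ Xs ∈ 𝓙)
  ¬FIP⇒ 𝓙 ¬fip = byContradiction λ none →
    ¬fip λ Xs Xs⊆𝓐 ⋂Xs∈𝓙 → none (Xs , Xs⊆𝓐 , ⋂Xs∈𝓙)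

  module _ {𝓙 : Family} (𝓙-ideal : IsIdeal 𝓙) where
    open IsIdeal 𝓙-ideal

    -- If both extensions fail, delete the copies of `X` and of `∁ X` from the two offending lists.
    -- The remaining members of `𝓐` have an intersection covered by two sets of `𝓙`, contradicting
    -- the FIP of `𝓐`.
    FIP-dichotomy : ∀ {𝓐} X → FIP 𝓙 𝓐 → FIP 𝓙 (𝓐 ∪｛ X ｝) ⊎ FIP 𝓙 (𝓐 ∪｛ ∁ X ｝)
    FIP-dichotomy {𝓐} X fip
      with lem {P = FIP 𝓙 (𝓐 ∪｛ X ｝)} | lem {P = FIP 𝓙 (𝓐 ∪｛ ∁ X ｝)}
    ... | yes fip⁺ | _        = inj₁ fip⁺
    ... | no  _    | yes fip⁻ = inj₂ fip⁻
    ... | no ¬fip⁺ | no ¬fip⁻ =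
      let Xs , Xs⊆ , ⋂Xs∈𝓙 = ¬FIP⇒ 𝓙 ¬fip⁺
          Ys , Ys⊆ , ⋂Ys∈𝓙 = ¬FIP⇒ 𝓙 ¬fip⁻
          Xs′ , Xs′⊆𝓐 , X-sub  = remove Xs⊆
          Ys′ , Ys′⊆𝓐 , ∁X-sub = remove Ys⊆
      in ⊥-elim (fip (Xs′ ++ Ys′) (++⁺ Xs′⊆𝓐 Ys′⊆𝓐) (⊆-closed
        (λ {n} n∈ → let n∈Xs′ , n∈Ys′ = ⋂-++⁻ Xs′ n∈ in
          cases (λ n∈X → X-sub (n∈Xs′ , n∈X)) (λ n∉X → ∁X-sub (n∈Ys′ , n∉X)))
        (∪-closed ⋂Xs∈𝓙 ⋂Ys∈𝓙)))
      where
      remove : ∀ {Z Xs} → All (_∈ 𝓐 ∪｛ Z ｝) Xs →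
               ∃[ Ys ] (All (_∈ 𝓐) Ys × ⋂ Ys ∩ Z ⊆ ⋂ Xs)
      remove [] = [] , [] , λ _ → tt
      remove (p ∷ ps) with p | remove ps
      ... | inj₁ X∈𝓐 | Ys , Ys⊆𝓐 , sub =
        _ ∷ Ys , X∈𝓐 ∷ Ys⊆𝓐 , λ ((x∈X , x∈Ys) , x∈Z) → x∈X , sub (x∈Ys , x∈Z)
      ... | inj₂ X≐Z | Ys , Ys⊆𝓐 , sub =
        Ys , Ys⊆𝓐 , λ (x∈Ys , x∈Z) → proj₂ X≐Z x∈Z , sub (x∈Ys , x∈Z)

      cases : {P Q R : Set} → (P → Q) → (¬ P → R) → Q ⊎ R
      cases {P} f g with lem {P = P}
      ... | yes p = inj₁ (f p)
      ... | no ¬p = inj₂ (g ¬p)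

    -- Run `Selection` along a well-order of all subsets, choosing `X` or `∁ X` at each `X`; the
    -- chosen sets form the ultrafilter.
    ultrafilter-extending : ∃[ 𝓤 ] (IsUltrafilter 𝓤 × 𝓙 ⊆ 𝓤 *)
    ultrafilter-extending = 𝓤 , ultrafilter , 𝓙⊆𝓤*
      where
      Option : Subset → Subset → Set
      Option X Z = Z ≐ X ⊎ Z ≐ ∁ X

      ∁-cong : ∀ {X Y} → X ≐ Y → ∁ X ≐ ∁ Y
      ∁-cong (X⊆Y , Y⊆X) = (λ x∉X x∈Y → x∉X (Y⊆X x∈Y)) , (λ x∉Y x∈X → x∉Y (X⊆Y x∈X))

      selected : ∃[ C ] ((∀ X → Option X (C X)) × (∀ D → FIP 𝓙 (image C D)))
      selected = Selection.selection 𝓙 proper (zermelo (≐-setoid ℕ 0ℓ)) Option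
        (λ X≐Y → [ (λ e → inj₁ (≐-trans e X≐Y)) , (λ e → inj₂ (≐-trans e (∁-cong X≐Y))) ]′)
        (λ X C _ fip →
          [ (λ fip⁺ → X , inj₁ ≐-refl , fip⁺) , (λ fip⁻ → ∁ X , inj₂ ≐-refl , fip⁻) ]′
            (FIP-dichotomy X fip))

      C        = proj₁ selected
      C-option = proj₁ (proj₂ selected)

      𝓤 : Family
      𝓤 Z = ∃[ X ] (C X ≐ Z)

      fip : FIP 𝓙 𝓤
      fip = FIP-antitone 𝓙 (λ (X , e) → X , lift tt , e) (proj₂ (proj₂ selected) (λ _ → Lift 1ℓ ⊤))

      ultra : ∀ X → X ∈ 𝓤 ⊎ ∁ X ∈ 𝓤
      ultra X = [ (λ e → inj₁ (X , e)) , (λ e → inj₂ (X , e)) ]′ (C-option X)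

      -- Otherwise `∁ X` was chosen, and adjoining it to `Xs` violates the FIP. The filter closure
      -- properties and `𝓙 ⊆ 𝓤 *` are all instances.
      forced : ∀ {X} Xs → All (_∈ 𝓤) Xs → (⋂ Xs ∩ ∁ X) ∈ 𝓙 → X ∈ 𝓤
      forced {X} Xs Xs⊆𝓤 rest∈𝓙 = [ id , (λ ∁X∈𝓤 → contradiction
        (⊆-closed (λ (x∉X , x∈Xs) → x∈Xs , x∉X) rest∈𝓙)
        (fip (∁ X ∷ Xs) (∁X∈𝓤 ∷ Xs⊆𝓤))) ]′ (ultra X)

      ∅∈𝓙 : ∀ {X} → X ⊆ ∅ → X ∈ 𝓙
      ∅∈𝓙 X⊆∅ = ⊆-closed X⊆∅ (contains-finite ∅-finite)

      ultrafilter : IsUltrafilter 𝓤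
      ultrafilter = record
        { ∩-closed          = λ {X} {Y} X∈ Y∈ → forced (X ∷ Y ∷ []) (X∈ ∷ Y∈ ∷ [])
            (∅∈𝓙 λ ((x∈X , x∈Y , _) , x∉) → x∉ (x∈X , x∈Y))
        ; ⊇-closed          = λ {X} X⊆Y X∈ → forced (X ∷ []) (X∈ ∷ [])
            (∅∈𝓙 λ ((x∈X , _) , x∉Y) → x∉Y (X⊆Y x∈X))
        ; contains-cofinite = λ fin → forced [] [] (⊆-closed proj₂ (contains-finite fin))
        ; proper            = λ ∅∈𝓤 → fip (∅ ∷ []) (∅∈𝓤 ∷ []) (∅∈𝓙 proj₁)
        ; ultra             = ultra
        }

      𝓙⊆𝓤* : 𝓙 ⊆ 𝓤 *
      𝓙⊆𝓤* {X} X∈𝓙 =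
        ∁ X , forced [] [] (⊆-closed (λ (_ , x∈) → byContradiction x∈) X∈𝓙) ,
        (λ x∈X x∉X → x∉X x∈X) , byContradiction

  -- From the bound on `𝔣𝔦𝔭` to the ultrafilter.

  module _
    {𝓘 𝓙 : Family} (𝓙-ideal : IsIdeal 𝓙) {𝓕 : FunctionFamily} {κ : Cardinal}
    (κ-fip : IsFIPNumber 𝓘 𝓙 𝓕 κ) (𝓕≤κ : ∣ 𝓕 ∣ᶠ ≤ᶜ κ)
    where
    open IsIdeal 𝓙-ideal using (proper; ⊆-closed)

    fip≤witness : ∀ {𝓐} → FIPWitness 𝓘 𝓙 𝓕 𝓐 → κ ≤ᶜ ∣ 𝓐 ∣
    fip≤witness {𝓐} witness =
      Composition.injection (proj₂ κ-fip ν (inj₂ (𝓐 , witness , bijection)))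
        (Bijection.injection bijection)
      where
      module 𝓐 = Setoid ∣ 𝓐 ∣

      -- A copy of `∣ 𝓐 ∣` with its equality lifted to the level that `Cardinal` prescribes.
      ν : Cardinal
      ν = record
        { Carrier       = 𝓐.Carrier
        ; _≈_           = λ X Y → Lift 1ℓ (X 𝓐.≈ Y)
        ; isEquivalence = record
          { refl  = λ {X} → lift (𝓐.refl {X})
          ; sym   = λ {X} {Y} (lift e) → lift (𝓐.sym {X} {Y} e)
          ; trans = λ {X} {Y} {Z} (lift d) (lift e) → lift (𝓐.trans {X} {Y} {Z} d e)
          }
        }

      bijection : ν ≈ᶜ ∣ 𝓐 ∣
      bijection = record
        { to        = id
        ; cong      = lower
        ; bijective = lift , λ X → X , lower
        }

    module _ (non-degenerate : IsSingleton 𝓕 → ∣ 𝓕 ∣ᶠ <ᶜ κ) where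

      -- {ω} replaces the family of earlier sets at the least element of 𝓕, where the
      -- latter is empty and so never has the FIP.
      FullOnly : Family
      FullOnly X = Lift 1ℓ (X ≐ U)

      FullOnly-FIP : HasFIP 𝓙 FullOnly
      FullOnly-FIP = (U , lift ≐-refl) , λ Xs Xs⊆ ⋂Xs∈𝓙 →
        proper (⊆-closed (λ _ → all Xs⊆) ⋂Xs∈𝓙)
        where
        all : ∀ {Xs n} → All (_∈ FullOnly) Xs → n ∈ ⋂ Xs
        all []                  = tt
        all (lift (_ , ⊇) ∷ ps) = ⊇ tt , all ps

      -- `FullOnly` has one element up to `≐`, so as a witness it would give `κ` at most one
      -- element. Then `𝓕` would be a singleton and `κ ≤ᶜ ∣ 𝓕 ∣ᶠ`, contrary to the strict inequality
      -- assumed for singletons.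
      FullOnly-not-witness : ∀ {f} → f ∈ 𝓕 → ¬ FIPWitness 𝓘 𝓙 𝓕 FullOnly
      FullOnly-not-witness {f} f∈𝓕 witness = proj₂ (non-degenerate singleton) κ≤𝓕
        where
        open Injection using (to)

        κ≤1 = fip≤witness witness
        𝓕≤1 = Composition.injection 𝓕≤κ κ≤1

        same : (X Y : Setoid.Carrier ∣ FullOnly ∣) → Setoid._≈_ ∣ FullOnly ∣ X Y
        same (_ , lift X≐U) (_ , lift Y≐U) = ≐-trans X≐U (≐-sym Y≐U)

        singleton : IsSingleton 𝓕
        singleton = f , f∈𝓕 , λ g g∈𝓕 →
          Injection.injective 𝓕≤1 {g , g∈𝓕} {f , f∈𝓕} (same (to 𝓕≤1 _) (to 𝓕≤1 _))

        κ≤𝓕 : κ ≤ᶜ ∣ 𝓕 ∣ᶠ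
        κ≤𝓕 = record
          { to        = λ _ → f , f∈𝓕
          ; cong      = λ _ _ → refl
          ; injective = λ _ → Injection.injective κ≤1 (same (to κ≤1 _) (to κ≤1 _))
          }

      extend-non-witness : ∀ {𝓐} → HasFIP 𝓙 𝓐 → ¬ FIPWitness 𝓘 𝓙 𝓕 𝓐 → ∀ {f} → f ∈ 𝓕 →
                           ∃[ B ] (B ∈ 𝓘 × FIP 𝓙 (𝓐 ∪｛ f ⊢ B ｝))
      extend-non-witness hasFIP ¬witness {f} f∈𝓕 = byContradiction λ none →
        ¬witness (hasFIP , λ all → let B , B∈𝓘 , _ , fip = all f f∈𝓕 in none (B , B∈𝓘 , fip))

      S : Setoid 1ℓ 0ℓ
      S = ∣ 𝓕 ∣ᶠ
      open Setoid S using (Carrier; _≈_)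

      Option : REL Carrier Subset 1ℓ
      Option (f , _) Z = ∃[ B ] (B ∈ 𝓘 × (f ⊢ B) ≐ Z)

      ⊢-cong : ∀ {f g : ℕ → ℕ} (B : Subset) → f ≗ g → (f ⊢ B) ≐ (g ⊢ B)
      ⊢-cong B f≗g = (λ {n} → subst B (f≗g n)) , (λ {n} → subst B (sym (f≗g n)))

      selected : ∃[ C ] ((∀ f → Option f (C f)) × (∀ D → FIP 𝓙 (image C D)))
      selected =
        Selection.selection 𝓙 proper W Option
          (λ f≗g (B , B∈𝓘 , e) → B , B∈𝓘 , ≐-trans (≐-sym (⊢-cong B f≗g)) e)
          extend
        where
        initial        = initialWellOrder (zermelo S)
        W              = proj₁ initial
        small-segments = proj₂ initial
        open WellOrder W using (_<_)

        extend : ∀ f C → (∀ {g h} → g ≈ h → C g ≡ C h) → FIP 𝓙 (image C (_< f)) →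
                 ∃[ Z ] (Option f Z × FIP 𝓙 (image C (_< f) ∪｛ Z ｝))
        extend x@(f , f∈𝓕) C C-cong fip with lem {P = Satisfiable (image C (_< x))}
        ... | yes nonempty =
          -- Were the earlier sets a witness, `∣ 𝓕 ∣ᶠ` would embed in `κ`, then in their family, and
          -- then in the segment below `x`, which the choice of `W` excludes.
          let B , B∈𝓘 , fip′ = extend-non-witness (nonempty , fip)
                (λ witness → small-segments x (Composition.injection 𝓕≤κ
                  (Composition.injection (fip≤witness witness) (∣image∣≤ {S} C C-cong (_< x)))))
                f∈𝓕
          in f ⊢ B , (B , B∈𝓘 , ≐-refl) , fip′
        ... | no empty =
          let B , B∈𝓘 , fip′ = extend-non-witness FullOnly-FIP (FullOnly-not-witness f∈𝓕) f∈𝓕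
          in f ⊢ B , (B , B∈𝓘 , ≐-refl) ,
             FIP-antitone 𝓙 [ (λ Z∈ → contradiction (_ , Z∈) empty) , inj₂ ]′ fip′

      exists-ultrafilter : ∃[ 𝓤 ] (IsUltrafilter 𝓤 × (¬ 𝓘 ≤[ 𝓕 ] 𝓤 *) × 𝓙 ⊆ 𝓤 *)
      exists-ultrafilter =
        let C , C-option , fip = selected
            𝓐 = image C (λ _ → Lift 1ℓ ⊤)
            𝓤 , ultrafilter , ideal⊆ =
              ultrafilter-extending (Generated-isIdeal {𝓐 = 𝓐} 𝓙-ideal (fip _))
        in 𝓤 , ultrafilter ,
           -- The set `B` selected for `f` defeats `f`: the complement of `f ⊢ B` lies in the
           -- generated ideal, hence in `𝓤 *`, so `f ⊢ B` cannot.
           (λ (f , f∈𝓕 , f⁻¹) → let B , B∈𝓘 , e = C-option (f , f∈𝓕) in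
             ∁∉* ultrafilter (f⁻¹ B B∈𝓘)
               (ideal⊆ (∁∈Generated 𝓙-ideal ((f , f∈𝓕) , lift tt , ≐-sym e)))) ,
           λ X∈𝓙 → ideal⊆ (⊆-Generated 𝓙-ideal X∈𝓙)

-- The three special families of functions.

¬singleton : ∀ {𝓕 : FunctionFamily} → id ∈ 𝓕 → suc ∈ 𝓕 → ¬ IsSingleton 𝓕
¬singleton id∈𝓕 suc∈𝓕 (f , _ , only) with trans (only id id∈𝓕 0) (sym (only suc suc∈𝓕 0))
... | ()

-- The identity is one-to-one and its preimages are the sets themselves.
𝓙⊆*⇒¬point : ∀ {𝓙 𝓤} → 𝓙 ⊆ 𝓤 * → ¬ IsIPoint 𝓙 𝓤
𝓙⊆*⇒¬point 𝓙⊆𝓤* (_ , not≤) = not≤ (id , id , λ B B∈𝓙 → 𝓙⊆𝓤* B∈𝓙)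

theorem3p2 : LEM → AxiomOfChoice →
    ∀ (𝓘 𝓙 : Family) → IsIdeal 𝓘 → IsIdeal 𝓙 →
    ∀ (𝓕 : FunctionFamily) (κ : Cardinal) →
    IsFIPNumber 𝓘 𝓙 𝓕 κ → ∣ 𝓕 ∣ᶠ ≤ᶜ κ →
    ((IsSingleton 𝓕 → ∣ 𝓕 ∣ᶠ <ᶜ κ) →
    ∃[ 𝓤 ] (IsUltrafilter 𝓤 × (¬ 𝓘 ≤[ 𝓕 ] 𝓤 *) × 𝓙 ⊆ 𝓤 *)) ×
    (𝓕 ≐ AllFunctions →
    ∃[ 𝓤 ] (IsIUltrafilter 𝓘 𝓤 × ¬ IsIPoint 𝓙 𝓤)) ×
    (𝓕 ≐ FiniteToOne →
    ∃[ 𝓤 ] (IsWeakIUltrafilter 𝓘 𝓤 × ¬ IsIPoint 𝓙 𝓤)) ×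
    (𝓕 ≐ OneToOne →
    ∃[ 𝓤 ] (IsIPoint 𝓘 𝓤 × ¬ IsIPoint 𝓙 𝓤))
theorem3p2 lem ac 𝓘 𝓙 _ 𝓙-ideal 𝓕 κ κ-fip 𝓕≤κ =
  main ,
  special tt tt ,
  special (finite-to-one id) (finite-to-one suc-injective) ,
  special id suc-injective
  where
  main : (IsSingleton 𝓕 → ∣ 𝓕 ∣ᶠ <ᶜ κ) →
         ∃[ 𝓤 ] (IsUltrafilter 𝓤 × (¬ 𝓘 ≤[ 𝓕 ] 𝓤 *) × 𝓙 ⊆ 𝓤 *)
  main = Choice.exists-ultrafilter lem ac 𝓙-ideal κ-fip 𝓕≤κ

  finite-to-one : ∀ {f} → OneToOne f → FiniteToOne f
  finite-to-one = Choice.injective⇒finite-to-one lem ac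

  special : {𝓖 : Pred (ℕ → ℕ) 0ℓ} → id ∈ 𝓖 → suc ∈ 𝓖 → 𝓕 ≐ 𝓖 →
            ∃[ 𝓤 ] ((IsUltrafilter 𝓤 × ¬ 𝓘 ≤[ 𝓖 ] 𝓤 *) × ¬ IsIPoint 𝓙 𝓤)
  special id∈ suc∈ (𝓕⊆𝓖 , 𝓖⊆𝓕) =
    let 𝓤 , ultrafilter , not≤ , 𝓙⊆𝓤* =
          -- Each of the three families contains both `id` and `suc`, so the degenerate case cannot
          -- occur.
          main (λ single → contradiction single (¬singleton (𝓖⊆𝓕 id∈) (𝓖⊆𝓕 suc∈)))
    in 𝓤 , (ultrafilter , λ (f , f∈𝓖 , f⁻¹) → not≤ (f , 𝓖⊆𝓕 f∈𝓖 , f⁻¹)) , 𝓙⊆*⇒¬point 𝓙⊆𝓤*
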